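{- Let $k$ be a positive integer and let $G$ be a $k$-connected graph on $n$ vertices. If $P$ and $Q$ are any two longest paths in $G$, then \[ |V(P)\cap V(Q)| \ge \min\left\{ k, \left\lceil \frac{8k-n-4}{3}\right\rceil\right\}. \]
   Context: All graphs are finite and simple. A graph is $k$-connected if it has more than $k$ vertices and remains connected after deleting any set of fewer than $k$ vertices. The length of a path is its number of edges, and a longest path in $G$ is a path of maximum length among all paths in $G$. $V(P)$ denotes the vertex set of $P$. -}

module Defs where

open import Data.Fin.Base using (Fin)
open import Data.Fin.Subset using (Subset; _∈_; ∁; ∣_∣; ⋃; ⁅_⁆)
open import Data.List.Base as List using (List; _∷_)
open import Data.List.Relation.Unary.Linked using (Linked)
open import Data.List.Relation.Unary.Unique.Propositional using (Unique)
open import Data.Nat.Base using (ℕ; _≤_; _<_)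
open import Data.Product.Base using (_×_; ∃; proj₁)
open import Function.Base using (_on_)
open import Level using (0ℓ)
open import Relation.Binary.Construct.Closure.ReflexiveTransitive using (Star)
open import Relation.Binary.Core using (Rel)
open import Relation.Binary.Definitions using (Decidable; Irreflexive; Symmetric)
open import Relation.Binary.PropositionalEquality.Core using (_≡_; cong)

-- Simple graphs with vertex type V; a finite graph on n vertices is a
-- Graph (Fin n).  Decidability of adjacency holds automatically
-- for finite graphs classically.
record Graph (V : Set) : Set₁ where
  field
    Adj        : Rel V 0ℓ
    adj?       : Decidable Adj
    adj-sym    : Symmetric Adj
    adj-irrefl : Irreflexive _≡_ Adj

open Graph public

Connected : {V : Set} → Graph V → Set
Connected {V} G = (u v : V) → Star (Adj G) u v

-- Membership in ∁ S, unlike ¬ (v ∈ S), is proof-irrelevant without function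
-- extensionality, so each surviving vertex occurs exactly once.
Remaining : {n : ℕ} → Subset n → Set
Remaining S = ∃ λ v → v ∈ ∁ S

delete : {n : ℕ} → Graph (Fin n) → (S : Subset n) → Graph (Remaining S)
delete G S = record
  { Adj        = Adj G on proj₁
  ; adj?       = λ u v → adj? G (proj₁ u) (proj₁ v)
  ; adj-sym    = adj-sym G
  ; adj-irrefl = λ u≡v → adj-irrefl G (cong proj₁ u≡v)
  }

_-Connected_ : {n : ℕ} → ℕ → Graph (Fin n) → Set
_-Connected_ {n} k G =
  k < n × ((S : Subset n) → ∣ S ∣ < k → Connected (delete G S))

-- A path is given by its sequence of vertices, starting at either end.
-- It has at least one vertex, and may have length 0.
record Path {V : Set} (G : Graph V) : Set where
  field
    start : V
    rest  : List V

  vertices : List V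
  vertices = start ∷ rest

  field
    linked : Linked (Adj G) vertices
    unique : Unique vertices

  length : ℕ
  length = List.length rest

open Path public

Longest : {V : Set} {G : Graph V} → Path G → Set
Longest {G = G} P = (Q : Path G) → length Q ≤ length P

vertexSet : {n : ℕ} {G : Graph (Fin n)} → Path G → Subset n
vertexSet P = ⋃ (List.map ⁅_⁆ (vertices P))

{-# OPTIONS --safe #-}
-- Let m = |V(P) ∩ V(Q)| < k, let p be the number of vertices of P, with ends
-- x₀ and x₁, let H be a component of G - V(P), and let N be the set of vertices
-- of P attached to H, so that |N| ≥ k. All neighbours of x₀ and of x₁ lie on P.
-- No successor of a vertex of N is a neighbour of x₀, and symmetrically, since P
-- could be extended into H; this gives p ≥ 2k. If some u, v, w are consecutive on
-- P with u ~ x₁ and w ~ x₀, then P minus v spans a cycle C; Q cannot have two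
-- consecutive vertices off C, so p ≤ 2m + 1 < 2k. Excluding this, N, the
-- predecessors of N(x₀) and the successors of N(x₁) are disjoint, so p ≥ 3k.
-- Likewise a chord pair skipping two vertices would yield p ≤ 3m + 2 < 3k. As
-- p > 2m + 1, Q has an edge off P, so H can be chosen with at least two vertices;
-- then between any two vertices of N there is a vertex of P in none of the three
-- sets, so p ≥ 4k - 1, and n ≥ 2p - m ≥ 8k - 2 - m. The steps about Q and cycles
-- assume k ≥ 2; for k = 1 the bound p ≥ 2k suffices.
module Submission where

open import Defs
open import Data.Nat.Base as ℕ using (ℕ)
open import Data.Fin.Base using (Fin)
open import Data.Fin.Subset using (∣_∣; _∩_)
open import Data.Integer.Base using (+_; _*_; _-_; _≥_; _⊓_)
open import Data.Rational.Unnormalised.Base using (_/_; ceiling)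
open import Data.Bool.Base using (Bool; true; false; not; if_then_else_)
open import Data.Empty using (⊥; ⊥-elim)
open import Data.Fin.Base using (zero; suc)
open import Data.Fin.Properties using (_≟_; any?)
open import Data.Fin.Subset as Subset using (Subset; inside; outside)
  renaming (_∈_ to _∈ˢ_; _∉_ to _∉ˢ_)
import Data.Fin.Subset.Properties as Subset
import Data.Integer.Base as ℤ
import Data.Integer.DivMod as ℤ
import Data.Integer.Properties as ℤ
open import Data.Integer.Tactic.RingSolver using () renaming (solve-∀ to ℤ-solve-∀)
open import Data.List.Base as List using (List; []; _∷_; _++_; _∷ʳ_; reverse)
import Data.List.Membership.DecPropositional as DecMembership
open import Data.List.Membership.Propositional using (_∈_; _∉_)
open import Data.List.Membership.Propositional.Properties
  using (∈-∃++; ∈-++⁺ˡ; ∈-++⁺ʳ; ∈-++⁻)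
open import Data.List.Properties as List
  using (++-assoc; length-++; length-reverse; unfold-reverse)
open import Data.List.Relation.Binary.Disjoint.Propositional using (Disjoint)
open import Data.List.Relation.Binary.Permutation.Propositional
  using (_↭_; ↭-reflexive; ↭-sym; ↭-trans; ↭⇒↭ₛ)
import Data.List.Relation.Binary.Permutation.Propositional.Properties as ↭
import Data.List.Relation.Binary.Permutation.Setoid.Properties as ↭ₛ
open import Data.List.Relation.Unary.All as All using (All; []; _∷_)
import Data.List.Relation.Unary.All.Properties as All
open import Data.List.Relation.Unary.AllPairs using ([]; _∷_)
open import Data.List.Relation.Unary.Any using (here; there)
open import Data.List.Relation.Unary.Linked using (Linked; [-]; _∷_)
open import Data.List.Relation.Unary.Unique.Propositional using (Unique)
import Data.List.Relation.Unary.Unique.Propositional.Properties as Unique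
open import Data.Nat.Base using (_≤_; _<_; z≤n; s≤s) renaming (_+_ to _⊕_; _*_ to _⊛_)
import Data.Nat.Properties as ℕ
open import Data.Nat.Tactic.RingSolver using (solve-∀)
open import Data.Product.Base using (_×_; _,_; ∃; ∃₂; proj₁; proj₂)
open import Data.Sum.Base using (_⊎_; inj₁; inj₂)
open import Data.Vec.Base as Vec using ([]; _∷_; there)
import Data.Vec.Properties as Vec
open import Function.Base using (_∘_)
open import Relation.Binary.Construct.Closure.ReflexiveTransitive using (Star; _◅_)
  renaming (ε to stop)
open import Relation.Binary.PropositionalEquality
  using (_≡_; refl; sym; trans; cong; cong₂; subst; subst₂; setoid)
open import Relation.Nullary using (¬_; ¬?; Dec; yes; no)
open import Relation.Nullary.Decidable
  using (does; dec-true; decidable-stable; ¬¬-excluded-middle)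

private
  variable
    A : Set
    n : ℕ

-- Counting labels along a list

bit : Bool → ℕ
bit b = if b then 1 else 0

count : (A → Bool) → List A → ℕ
count f []       = 0
count f (x ∷ xs) = bit (f x) ⊕ count f xs

true-or-false : ∀ b → b ≡ true ⊎ b ≡ false
true-or-false true  = inj₁ refl
true-or-false false = inj₂ refl

bits≤1 : ∀ a b c → (a ≡ true → b ≡ true → ⊥) → (a ≡ true → c ≡ true → ⊥) →
         (b ≡ true → c ≡ true → ⊥) → bit a ⊕ bit b ⊕ bit c ≤ 1
bits≤1 true  true  _     ab _  _  = ⊥-elim (ab refl refl)
bits≤1 true  false true  _  ac _  = ⊥-elim (ac refl refl)
bits≤1 true  false false _  _  _  = s≤s z≤n
bits≤1 false true  true  _  _  bc = ⊥-elim (bc refl refl)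
bits≤1 false true  false _  _  _  = s≤s z≤n
bits≤1 false false true  _  _  _  = s≤s z≤n
bits≤1 false false false _  _  _  = z≤n

≢true⇒≡false : ∀ {b} → (b ≡ true → ⊥) → b ≡ false
≢true⇒≡false {true}  ¬b = ⊥-elim (¬b refl)
≢true⇒≡false {false} _  = refl

++-∷-assoc : ∀ (α : List A) u r → α ++ u ∷ r ≡ (α ∷ʳ u) ++ r
++-∷-assoc α u r = sym (++-assoc α (u ∷ []) r)

-- Position v of xs is labelled by L if L holds at its
-- predecessor, by F if F holds at its successor, and by N if N holds at v.
module Labels (xs : List A) (F L N : A → Bool)
  (last∉L : ∀ α v → xs ≡ α ++ v ∷ [] → L v ≡ false)
  (NF : ∀ α v w β → xs ≡ α ++ v ∷ w ∷ β → N v ≡ true → F w ≡ true → ⊥)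
  (LN : ∀ α v w β → xs ≡ α ++ v ∷ w ∷ β → L v ≡ true → N w ≡ true → ⊥)
  (L·F : ∀ α u v w β → xs ≡ α ++ u ∷ v ∷ w ∷ β → L u ≡ true → F w ≡ true → ⊥)
  where

  module _ (α : List A) (u v : A) where

    last-label≤1 : xs ≡ α ++ u ∷ v ∷ [] → bit (L u) ⊕ 0 ⊕ bit (N v) ≤ 1
    last-label≤1 eq = bits≤1 (L u) false (N v) (λ _ ()) (LN α u v [] eq) (λ ())

    label≤1 : ∀ w r → xs ≡ α ++ u ∷ v ∷ w ∷ r → bit (L u) ⊕ bit (F w) ⊕ bit (N v) ≤ 1
    label≤1 w r eq = bits≤1 (L u) (F w) (N v) (L·F α u v w r eq)
      (LN α u v (w ∷ r) eq)
      (λ Fw Nv → NF (α ∷ʳ u) v w r (trans eq (++-∷-assoc α u _)) Nv Fw)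

    last-v : xs ≡ α ++ u ∷ v ∷ [] → L v ≡ false
    last-v eq = last∉L (α ∷ʳ u) v (trans eq (++-∷-assoc α u _))

  private
    regroup : ∀ a b c d e f g → a ⊕ (b ⊕ e) ⊕ (d ⊕ f) ⊕ (c ⊕ g) ≡ (a ⊕ b ⊕ c) ⊕ (d ⊕ e ⊕ f ⊕ g)
    regroup = solve-∀

    regroup₀ : ∀ a c → a ⊕ 0 ⊕ 0 ⊕ (c ⊕ 0) ≡ a ⊕ 0 ⊕ c
    regroup₀ = solve-∀

  -- The sum collects the labels of the positions in `v ∷ r`, each of which carries at most one. The
  -- predecessor `u` is kept because it decides the label `L` of `v`; the last vertex passes no
  -- label on, by `last∉L`.
  labels-suffix : ∀ α u v r → xs ≡ α ++ u ∷ v ∷ r →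
    bit (L u) ⊕ count F r ⊕ count L (v ∷ r) ⊕ count N (v ∷ r) ≤ List.length (v ∷ r)
  labels-suffix α u v [] eq rewrite last-v α u v eq =
    ℕ.≤-trans (ℕ.≤-reflexive (regroup₀ (bit (L u)) (bit (N v)))) (last-label≤1 α u v eq)
  labels-suffix α u v (w ∷ r) eq =
    ℕ.≤-trans (ℕ.≤-reflexive (regroup (bit (L u)) (bit (F w)) (bit (N v)) (bit (L v)) (count F r)
        (count L (w ∷ r)) (count N (w ∷ r))))
      (ℕ.+-mono-≤ (label≤1 α u v w r eq)
        (labels-suffix (α ∷ʳ u) v w r (trans eq (++-∷-assoc α u _))))

  labels : ∀ x r → xs ≡ x ∷ r → count F r ⊕ count L xs ⊕ count N xs ≤ List.length xs
  labels x [] refl rewrite last∉L [] x refl with N x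
  ... | true  = s≤s z≤n
  ... | false = z≤n
  labels x (w ∷ r) refl =
    ℕ.≤-trans (ℕ.≤-reflexive (regroup 0 (bit (F w)) (bit (N x)) (bit (L x)) (count F r)
        (count L (w ∷ r)) (count N (w ∷ r))))
      (ℕ.+-mono-≤
        (bits≤1 false (F w) (N x) (λ ()) (λ ()) (λ Fw Nx → NF [] x w r refl Nx Fw))
        (labels-suffix [] x w r refl))

  module Gaps
    (NN : ∀ α v w β → xs ≡ α ++ v ∷ w ∷ β → N v ≡ true → N w ≡ true → ⊥)
    (N·F : ∀ α u v w β → xs ≡ α ++ u ∷ v ∷ w ∷ β → N u ≡ true → F w ≡ true → ⊥)
    (L·N : ∀ α u v w β → xs ≡ α ++ u ∷ v ∷ w ∷ β → L u ≡ true → N w ≡ true → ⊥)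
    (L··F : ∀ α t u v w β → xs ≡ α ++ t ∷ u ∷ v ∷ w ∷ β → L t ≡ true → F w ≡ true → ⊥)
    where

    private
      regroup² : ∀ a b c d e f g → a ⊕ (b ⊕ e) ⊕ (d ⊕ f) ⊕ ((c ⊕ g) ⊕ (c ⊕ g)) ≡
                 ((a ⊕ b ⊕ c) ⊕ c) ⊕ (d ⊕ e ⊕ f ⊕ (g ⊕ g))
      regroup² = solve-∀

      regroup²₀ : ∀ a c → a ⊕ 0 ⊕ 0 ⊕ ((c ⊕ 0) ⊕ (c ⊕ 0)) ≡ (a ⊕ 0 ⊕ c) ⊕ c
      regroup²₀ = solve-∀

    -- `N` is counted twice so that each of its vertices is also charged for an unlabelled position
    -- before the next one.
    weight : A → A → List A → ℕ
    weight u v r =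
      bit (L u) ⊕ count F r ⊕ count L (v ∷ r) ⊕ (count N (v ∷ r) ⊕ count N (v ∷ r))

    -- No unlabelled position has occurred since the last one labelled N: the
    -- first label after N cannot be F and a label L is never followed by a label
    -- F, so all labels in between are L.
    Debt : List A → A → Set
    Debt α u = N u ≡ true ⊎ ∃₂ λ α′ t → α ≡ α′ ∷ʳ t × L t ≡ true

    debt⇒¬N : ∀ α u v r → xs ≡ α ++ u ∷ v ∷ r → Debt α u → N v ≡ false
    debt⇒¬N α u v r eq (inj₁ Nu) = ≢true⇒≡false (NN α u v r eq Nu)
    debt⇒¬N _ u v r eq (inj₂ (α , t , refl , Lt)) =
      ≢true⇒≡false (L·N α t u v r (trans eq (sym (++-∷-assoc α t _))) Lt)

    debt⇒¬F : ∀ α u v w r → xs ≡ α ++ u ∷ v ∷ w ∷ r → Debt α u → F w ≡ false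
    debt⇒¬F α u v w r eq (inj₁ Nu) = ≢true⇒≡false (N·F α u v w r eq Nu)
    debt⇒¬F _ u v w r eq (inj₂ (α , t , refl , Lt)) =
      ≢true⇒≡false (L··F α t u v w r (trans eq (sym (++-∷-assoc α t _))) Lt)

    -- The extra unit in `free` covers the last vertex of `N`, which has no later one to be
    -- separated from. In `debt` that unit is already spent, and only an unlabelled position
    -- restores it.
    free : ∀ α u v r → xs ≡ α ++ u ∷ v ∷ r → weight u v r ≤ 1 ⊕ List.length (v ∷ r)
    debt : ∀ α u v r → xs ≡ α ++ u ∷ v ∷ r → Debt α u → weight u v r ≤ List.length (v ∷ r)

    free α u v [] eq rewrite last-v α u v eq =
      ℕ.≤-trans (ℕ.≤-reflexive (regroup²₀ (bit (L u)) (bit (N v))))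
        (ℕ.+-mono-≤ (last-label≤1 α u v eq) (bit≤1 (N v)))
      where
      bit≤1 : ∀ b → bit b ≤ 1
      bit≤1 true  = s≤s z≤n
      bit≤1 false = z≤n
    free α u v (w ∷ r) eq =
      ℕ.≤-trans
        (ℕ.≤-reflexive (regroup² (bit (L u)) (bit (F w)) (bit (N v)) (bit (L v)) (count F r)
        (count L (w ∷ r)) (count N (w ∷ r))))
        (step (N v) refl)
      where
      eq′ = trans eq (++-∷-assoc α u _)
      step : ∀ b → N v ≡ b →
        (bit (L u) ⊕ bit (F w) ⊕ bit (N v)) ⊕ bit b ⊕ weight v w r ≤ 2 ⊕ List.length (w ∷ r)
      -- The second copy of `N v` consumes the spare unit, so the rest must be bounded by `debt`.
      step true  Nv = ℕ.+-mono-≤ (ℕ.+-monoˡ-≤ 1 (label≤1 α u v w r eq))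
                        (debt (α ∷ʳ u) v w r eq′ (inj₁ Nv))
      step false Nv = ℕ.≤-trans
        (ℕ.+-mono-≤ (ℕ.+-monoˡ-≤ 0 (label≤1 α u v w r eq)) (free (α ∷ʳ u) v w r eq′))
        ℕ.≤-refl

    debt α u v [] eq d rewrite last-v α u v eq | debt⇒¬N α u v [] eq d with L u
    ... | true  = s≤s z≤n
    ... | false = z≤n
    debt α u v (w ∷ r) eq d rewrite debt⇒¬N α u v (w ∷ r) eq d | debt⇒¬F α u v w r eq d =
      ℕ.≤-trans (ℕ.≤-reflexive (regroup² (bit (L u)) 0 0 (bit (L v)) (count F r)
        (count L (w ∷ r)) (count N (w ∷ r))))
        (step (true-or-false (L u)))
      where
      eq′ = trans eq (++-∷-assoc α u _)
      step : L u ≡ true ⊎ L u ≡ false →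
        (bit (L u) ⊕ 0 ⊕ 0) ⊕ 0 ⊕ weight v w r ≤ 1 ⊕ List.length (w ∷ r)
      -- A label `L` on `v` prolongs the debt; otherwise `v` is unlabelled and the debt is paid.
      step (inj₁ Lu) rewrite Lu = s≤s (debt (α ∷ʳ u) v w r eq′ (inj₂ (α , u , refl , Lu)))
      step (inj₂ Lu) rewrite Lu = free (α ∷ʳ u) v w r eq′

    gaps : ∀ x r → xs ≡ x ∷ r → N x ≡ false →
      count F r ⊕ count L xs ⊕ (count N xs ⊕ count N xs) ≤ 1 ⊕ List.length xs
    gaps x [] refl Nx rewrite last∉L [] x refl | Nx = z≤n
    gaps x (w ∷ r) refl Nx rewrite Nx =
      ℕ.≤-trans (ℕ.≤-reflexive (regroup² 0 (bit (F w)) 0 (bit (L x)) (count F r)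
        (count L (w ∷ r)) (count N (w ∷ r))))
        (ℕ.≤-trans (ℕ.+-mono-≤ (bit≤1 (F w)) (free [] x w r refl)) ℕ.≤-refl)
      where
      bit≤1 : ∀ b → bit b ⊕ 0 ⊕ 0 ≤ 1
      bit≤1 true  = s≤s z≤n
      bit≤1 false = z≤n

-- With c marked entries there are c + 1 unmarked runs of at most `r` entries each, and c + (c + 1)r
-- = (1 + r)c + r. In `run`, `γ` is the unmarked run in progress.
count≤length : ∀ r (f : A → Bool) ys →
  (∀ α γ β → ys ≡ α ++ γ ++ β → All (λ v → f v ≡ false) γ → List.length γ ≤ r) →
  List.length ys ≤ (1 ⊕ r) ⊛ count f ys ⊕ r
count≤length {A = A} r f xs runs = run [] [] xs refl []
  where
  run : ∀ α γ ys → xs ≡ α ++ γ ++ ys → All (λ v → f v ≡ false) γ →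
        List.length γ ⊕ List.length ys ≤ (1 ⊕ r) ⊛ count f ys ⊕ r
  run α γ [] eq out = ℕ.≤-trans (ℕ.≤-reflexive (ℕ.+-identityʳ _))
    (ℕ.≤-trans (runs α γ [] eq out) (ℕ.m≤n+m r _))
  run α γ (y ∷ ys) eq out with f y in fy
  ... | false = ℕ.≤-trans
    (ℕ.≤-reflexive (trans (ℕ.+-suc _ _)
      (cong (_⊕ List.length ys) (trans (sym (ℕ.+-comm _ 1)) (sym (length-++ γ))))))
    (run α (γ ∷ʳ y) ys (trans eq (cong (α ++_) (++-∷-assoc γ y ys)))
      (All.++⁺ out (fy ∷ [])))
  ... | true  = ℕ.≤-trans
    (ℕ.+-mono-≤ (runs α γ (y ∷ ys) eq out)
      (s≤s (run (α ++ γ ∷ʳ y) [] ys eq′ [])))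
    (ℕ.≤-reflexive (shuffle r (count f ys)))
    where
    eq′ : xs ≡ (α ++ γ ∷ʳ y) ++ ys
    eq′ = trans eq (trans (cong (α ++_) (++-∷-assoc γ y ys)) (sym (++-assoc α (γ ∷ʳ y) ys)))
    shuffle : ∀ r c → r ⊕ (1 ⊕ ((1 ⊕ r) ⊛ c ⊕ r)) ≡ (1 ⊕ r) ⊛ (1 ⊕ c) ⊕ r
    shuffle = solve-∀

-- Cardinalities of subsets against counts along lists

∣p∣≤1+∣p-x∣ : ∀ (p : Subset n) x → ∣ p ∣ ≤ 1 ⊕ ∣ p Subset.- x ∣
∣p∣≤1+∣p-x∣ (inside  ∷ p) zero    = s≤s (ℕ.≤-reflexive (sym (cong ∣_∣ (Subset.p─⊥≡p p))))
∣p∣≤1+∣p-x∣ (outside ∷ p) zero    = ℕ.m≤n⇒m≤1+n (ℕ.≤-reflexive (sym (cong ∣_∣ (Subset.p─⊥≡p p))))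
∣p∣≤1+∣p-x∣ (inside  ∷ p) (suc x) = s≤s (∣p∣≤1+∣p-x∣ p x)
∣p∣≤1+∣p-x∣ (outside ∷ p) (suc x) = ∣p∣≤1+∣p-x∣ p x

x∉p-x : ∀ (p : Subset n) x → x ∉ˢ p Subset.- x
x∉p-x (_ ∷ p) zero    ()
x∉p-x (_ ∷ p) (suc x) (there x∈) = x∉p-x p x x∈

-- Each marked entry accounts for at most one element of `S`, which is removed before the recursion.
card≤count : ∀ (f : Fin n → Bool) xs (S : Subset n) →
  (∀ {v} → v ∈ˢ S → v ∈ xs × f v ≡ true) → ∣ S ∣ ≤ count f xs
card≤count {n} f [] S S⊆ = ℕ.≤-reflexive
  (trans (cong ∣_∣ (Subset.Empty-unique λ (_ , v∈S) → case-[] (proj₁ (S⊆ v∈S)))) (Subset.∣⊥∣≡0 n))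
  where
  case-[] : ∀ {v : Fin n} → v ∈ [] → ⊥
  case-[] ()
card≤count f (x ∷ xs) S S⊆ with f x in fx
... | true  = ℕ.≤-trans (∣p∣≤1+∣p-x∣ S x) (s≤s (card≤count f xs (S Subset.- x) S-x⊆))
  where
  S-x⊆ : ∀ {v} → v ∈ˢ S Subset.- x → v ∈ xs × f v ≡ true
  S-x⊆ v∈ with S⊆ (Subset.p─q⊆p S _ v∈)
  ... | here refl , _  = ⊥-elim (x∉p-x S _ v∈)
  ... | there v∈xs , fv = v∈xs , fv
... | false = card≤count f xs S S⊆′
  where
  S⊆′ : ∀ {v} → v ∈ˢ S → v ∈ xs × f v ≡ true
  S⊆′ v∈ with S⊆ v∈
  ... | here refl , fv rewrite fx with () ← fv
  ... | there v∈xs , fv = v∈xs , fv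

-- Uniqueness keeps the later marked entries in `S` after `x` has been removed.
count≤card : ∀ (f : Fin n → Bool) {xs} → Unique xs → (S : Subset n) →
  (∀ {v} → v ∈ xs → f v ≡ true → v ∈ˢ S) → count f xs ≤ ∣ S ∣
count≤card f [] S ⊆S = z≤n
count≤card f {x ∷ xs} (x∉ ∷ uniq) S ⊆S with f x in fx
... | false = count≤card f uniq S (⊆S ∘ there)
... | true  = ℕ.≤-trans
  (s≤s (count≤card f uniq (S Subset.- x)
    λ v∈ fv → Subset.x∈p∧x≢y⇒x∈p-y (⊆S (there v∈) fv) (All.lookup x∉ v∈ ∘ sym)))
  (Subset.x∈p⇒∣p-x∣<∣p∣ (⊆S (here refl) fx))

count-true : ∀ (xs : List A) → count (λ _ → true) xs ≡ List.length xs
count-true []       = refl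
count-true (x ∷ xs) = cong (1 ⊕_) (count-true xs)

n≤length : ∀ (xs : List (Fin n)) → (∀ v → v ∈ xs) → n ≤ List.length xs
n≤length {n} xs all = ℕ.≤-trans (ℕ.≤-reflexive (sym (Subset.∣⊤∣≡n n)))
  (ℕ.≤-trans (card≤count (λ _ → true) xs Subset.⊤ (λ {v} _ → all v , refl))
    (ℕ.≤-reflexive (count-true xs)))

⟦_⟧ : (Fin n → Bool) → Subset n
⟦ f ⟧ = Vec.tabulate f

∈⟦⟧⁺ : ∀ (f : Fin n → Bool) {v} → f v ≡ true → v ∈ˢ ⟦ f ⟧
∈⟦⟧⁺ f {v} fv = Vec.lookup⇒[]= v _ (trans (Vec.lookup∘tabulate f v) fv)

∈⟦⟧⁻ : ∀ (f : Fin n → Bool) {v} → v ∈ˢ ⟦ f ⟧ → f v ≡ true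
∈⟦⟧⁻ f {v} v∈ = trans (sym (Vec.lookup∘tabulate f v)) (Vec.[]=⇒lookup v∈)

does⁻ : ∀ {P : Set} (d : Dec P) → does d ≡ true → P
does⁻ (yes p) _ = p

Unique-↭ : ∀ {xs ys : List A} → xs ↭ ys → Unique xs → Unique ys
Unique-↭ {A = A} p = ↭ₛ.Unique-resp-↭ (setoid A) (↭⇒↭ₛ p)

Unique-++⁻ : ∀ (xs : List A) {ys} → Unique (xs ++ ys) → Unique xs × Unique ys × Disjoint xs ys
Unique-++⁻ []       u = [] , u , λ ()
Unique-++⁻ (x ∷ xs) (x∉ ∷ u) with Unique-++⁻ xs u
... | uxs , uys , dis = All.++⁻ˡ xs x∉ ∷ uxs , uys , dis′
  where
  dis′ : Disjoint (x ∷ xs) _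
  dis′ (here refl , v∈ys)  = All.lookup (All.++⁻ʳ xs x∉) v∈ys refl
  dis′ (there v∈xs , v∈ys) = dis (v∈xs , v∈ys)

_∈?_ : (v : Fin n) (xs : List (Fin n)) → Dec (v ∈ xs)
_∈?_ = DecMembership._∈?_ _≟_

-- Walks indexed by their ends and vertex lists

data Walk (G : Graph (Fin n)) : Fin n → List (Fin n) → Fin n → Set where
  end  : ∀ {a} → Walk G a (a ∷ []) a
  step : ∀ {a b c xs} → Adj G a b → Walk G b xs c → Walk G a (a ∷ xs) c

module Walks (G : Graph (Fin n)) where

  private
    variable
      a b c d v w : Fin n
      xs ys zs    : List (Fin n)

  walk-++ : Walk G a xs b → Adj G b c → Walk G c ys d → Walk G a (xs ++ ys) d
  walk-++ end        bc q = step bc q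
  walk-++ (step e p) bc q = step e (walk-++ p bc q)

  walk-reverse : Walk G a xs b → Walk G b (reverse xs) a
  walk-reverse end = end
  walk-reverse (step {a} {xs = xs} e p) = subst (λ zs → Walk G _ zs a)
    (sym (unfold-reverse a xs)) (walk-++ (walk-reverse p) (adj-sym G e) end)

  head≡ : Walk G a (v ∷ xs) b → a ≡ v
  head≡ end        = refl
  head≡ (step _ _) = refl

  singleton-ends : Walk G a (v ∷ []) b → v ≡ b
  singleton-ends end         = refl
  singleton-ends (step _ ())

  walk-split : ∀ α {β} → Walk G a (α ++ v ∷ β) b → Walk G a (α ∷ʳ v) v × Walk G v (v ∷ β) b
  walk-split []          p          with refl ← head≡ p = end , p
  walk-split (_ ∷ [])      (step e p) with q , r ← walk-split [] p      = step e q , r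
  walk-split (_ ∷ α@(_ ∷ _)) (step e p) with q , r ← walk-split α p = step e q , r

  walk-uncons : ∀ {β} → Walk G v (v ∷ w ∷ β) b → Adj G v w × Walk G w (w ∷ β) b
  walk-uncons (step e p) with refl ← head≡ p = e , p

  walk-join : Walk G a xs b → Walk G b (b ∷ ys) c → Walk G a (xs ++ ys) c
  walk-join p end        = subst (λ zs → Walk G _ zs _) (sym (List.++-identityʳ _)) p
  walk-join p (step e q) = walk-++ p e q

  walk-tail : ∀ δ {ε} → Walk G a (d ∷ δ ++ v ∷ ε) b → ∃ λ c → Adj G a c × Walk G c (δ ++ v ∷ ε) b
  walk-tail []      (step e p) = _ , e , p
  walk-tail (_ ∷ _) (step e p) = _ , e , p

  -- An edge from the end to the start closes the walk, so it can be reopened at any vertex. Each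
  -- step moves the first vertex to the end.
  rotate : ∀ δ {ε} → Walk G a (δ ++ v ∷ ε) b → Adj G b a → ∃ λ c → Walk G v (v ∷ ε ++ δ) c
  rotate {a} {b = b} [] p ba with refl ← head≡ p =
    b , subst (λ zs → Walk G a zs b) (sym (List.++-identityʳ _)) p
  rotate {a} {v} (d ∷ δ) {ε} p ba with refl ← head≡ p with c , ac , q ← walk-tail δ p =
    let b′ , r = rotate δ (subst (λ zs → Walk G c zs a) (++-assoc δ (v ∷ ε) (a ∷ []))
                            (walk-++ q ba end)) ac
    in b′ , subst (λ zs → Walk G v zs b′) (++-assoc (v ∷ ε) (a ∷ []) δ) r

  start∈ : Walk G a xs b → a ∈ xs
  start∈ end        = here refl
  start∈ (step _ _) = here refl

  end∈ : Walk G a xs b → b ∈ xs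
  end∈ end        = here refl
  end∈ (step _ p) = there (end∈ p)

  cons-start : Walk G a xs b → ∃ λ r → xs ≡ a ∷ r
  cons-start end        = [] , refl
  cons-start (step _ _) = _ , refl

  linked⇒walk : ∀ x xs → Linked (Adj G) (x ∷ xs) → ∃ λ y → Walk G x (x ∷ xs) y
  linked⇒walk x []       _       = x , end
  linked⇒walk x (w ∷ xs) (e ∷ l) with y , p ← linked⇒walk w xs l = y , step e p

  walk⇒linked : Walk G a xs b → Linked (Adj G) xs
  walk⇒linked end                   = [-]
  walk⇒linked (step e end)          = e ∷ [-]
  walk⇒linked (step e p@(step _ _)) = e ∷ walk⇒linked p

  -- If the new first vertex recurs, everything before its later occurrence is dropped.
  erase-loops : Walk G a xs b → ∃ λ ys → Walk G a ys b × Unique ys × (∀ {v} → v ∈ ys → v ∈ xs)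
  erase-loops end = _ , end , [] ∷ [] , λ v∈ → v∈
  erase-loops (step {a} e p) with erase-loops p
  ... | ys , q , uys , ys⊆ with a ∈? ys
  ...   | no a∉   = a ∷ ys , step e q , All.¬Any⇒All¬ ys a∉ ∷ uys ,
                    λ { (here eq) → here eq ; (there v∈) → there (ys⊆ v∈) }
  ...   | yes a∈ with α , β , refl ← ∈-∃++ a∈ =
    a ∷ β , proj₂ (walk-split α q) , proj₁ (proj₂ (Unique-++⁻ α uys)) , there ∘ ys⊆ ∘ ∈-++⁺ʳ α

  first-hit : ∀ cs → Walk G a xs b → a ∉ cs → b ∈ cs →
    ∃₂ λ ys z → ∃ λ c → Walk G a ys z × (∀ {v} → v ∈ ys → v ∈ xs × v ∉ cs) × Adj G z c × c ∈ cs
  first-hit cs end a∉ b∈ = ⊥-elim (a∉ b∈)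
  first-hit cs (step {a} {b} e p) a∉ b∈ with b ∈? cs
  ... | yes b∈cs = a ∷ [] , a , b , end , (λ { (here refl) → here refl , a∉ }) , e , b∈cs
  ... | no  b∉cs with ys , z , c , q , ys⊆ , zc , c∈ ← first-hit cs p b∉cs b∈ =
    a ∷ ys , z , c , step e q ,
    (λ { (here refl) → here refl , a∉
       ; (there v∈) → there (proj₁ (ys⊆ v∈)) , proj₂ (ys⊆ v∈) }) ,
    zc , c∈

  module _ {k : ℕ} (conn : k -Connected G) (S : Subset n) where

    walk-avoiding : ∣ S ∣ < k → a ∉ˢ S → b ∉ˢ S → ∃ λ xs → Walk G a xs b × (∀ {v} → v ∈ xs → v ∉ˢ S)
    walk-avoiding {a} {b} <k a∉ b∉ =
      go (proj₂ conn S <k (a , Subset.x∉p⇒x∈∁p a∉) (b , Subset.x∉p⇒x∈∁p b∉))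
      where
      go : ∀ {u v} → Star (Adj (delete G S)) u v →
        ∃ λ xs → Walk G (proj₁ u) xs (proj₁ v) × (∀ {v} → v ∈ xs → v ∉ˢ S)
      go {u , u∈} stop = u ∷ [] , end , λ { (here refl) → Subset.x∈∁p⇒x∉p u∈ }
      go {u , u∈} (e ◅ es) with xs , p , avoid ← go es =
        u ∷ xs , step e p , λ { (here refl) → Subset.x∈∁p⇒x∉p u∈ ; (there v∈) → avoid v∈ }

    -- If `S` had fewer than `k` vertices, some walk from `a` to `b` would avoid it, and `D` would
    -- spread along that walk to `b`.
    k≤∣separator∣ : (D : Fin n → Set) → D a → ¬ D b → a ∉ˢ S → b ∉ˢ S →
      (∀ {u v} → D u → Adj G u v → v ∉ˢ S → D v) → k ≤ ∣ S ∣
    k≤∣separator∣ {a} {b} D Da ¬Db a∉ b∉ closed with ∣ S ∣ ℕ.<? k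
    ... | no  ≮k = ℕ.≮⇒≥ ≮k
    ... | yes <k with xs , p , avoid ← walk-avoiding <k a∉ b∉ = ⊥-elim (¬Db (go p Da avoid))
      where
      go : ∀ {u v xs} → Walk G u xs v → D u → (∀ {v} → v ∈ xs → v ∉ˢ S) → D v
      go end        Du avoid = Du
      go (step e p) Du avoid = go p (closed Du e (avoid (there (start∈ p)))) (avoid ∘ there)

-- Exchange arguments on a longest path with `p` vertices

module LongestWalk (G : Graph (Fin n)) {p : ℕ}
  (maximal : ∀ {a b xs} → Walk G a xs b → Unique xs → List.length xs ≤ p)
  {x₀ x₁ : Fin n} {xs : List (Fin n)}
  (walk : Walk G x₀ xs x₁) (uniq : Unique xs) (len : List.length xs ≡ p)
  where

  open Walks G

  private
    variable
      a b e h u v w : Fin n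
      zs E R        : List (Fin n)

  maximal-↭ : Walk G a zs b → zs ↭ E ++ R → Unique E → Unique R → Disjoint E R →
              List.length E ⊕ List.length R ≤ p
  maximal-↭ {E = E} {R = R} q perm uE uR dis = ℕ.≤-trans
    (ℕ.≤-reflexive (trans (sym (length-++ E)) (sym (↭.↭-length perm))))
    (maximal q (Unique-↭ (↭-sym perm) (Unique.++⁺ uE uR dis)))

  module Cut (α : List (Fin n)) (v : Fin n) (γ : List (Fin n)) (w : Fin n) (β : List (Fin n))
    (eq : xs ≡ α ++ v ∷ γ ++ w ∷ β) where

    left right : List (Fin n)
    left  = α ∷ʳ v
    right = w ∷ β

    walkˡ : Walk G x₀ left v
    walkˡ = proj₁ (walk-split α (subst (λ zs → Walk G x₀ zs x₁) eq walk))

    walkʳ : Walk G w right x₁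
    walkʳ = proj₂ (walk-split (α ++ v ∷ γ) (subst (λ zs → Walk G x₀ zs x₁) eq′ walk))
      where
      eq′ : xs ≡ (α ++ v ∷ γ) ++ w ∷ β
      eq′ = trans eq (sym (++-assoc α (v ∷ γ) (w ∷ β)))

    xs↭ : xs ↭ γ ++ left ++ right
    xs↭ = ↭-trans (↭-reflexive (trans eq (++-∷-assoc α v _))) (↭.shifts left γ)

    uniqᵏ : Unique (left ++ right)
    uniqᵏ = proj₁ (proj₂ (Unique-++⁻ γ (Unique-↭ xs↭ uniq)))

    lenᵏ : List.length γ ⊕ List.length (left ++ right) ≡ p
    lenᵏ = trans (sym (length-++ γ)) (trans (sym (↭.↭-length xs↭)) len)

    ⊆xs : u ∈ left ++ right → u ∈ xs
    ⊆xs = ↭.∈-resp-↭ (↭-sym xs↭) ∘ ∈-++⁺ʳ γ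

    -- The new path replaces `γ` by `E` and keeps all other vertices, so maximality compares just
    -- these two lists.
    shorter : Walk G a zs b → zs ↭ E ++ left ++ right → Unique E → Disjoint E xs →
              List.length E ≤ List.length γ
    shorter {E = E} q perm uE dis = ℕ.+-cancelʳ-≤ (List.length (left ++ right)) _ _
      (ℕ.≤-trans (maximal-↭ {E = E} q perm uE uniqᵏ λ (∈E , ∈R) → dis (∈E , ⊆xs ∈R))
        (ℕ.≤-reflexive (sym lenᵏ)))

    -- The path runs through `E` to `v`, back along `left` to `x₀`, then jumps to `w` and follows
    -- `right`.
    detour-start : Adj G x₀ w → Walk G e E h → Unique E → Disjoint E xs → Adj G h v →
                   List.length E ≤ List.length γ
    detour-start {E = E} x₀w q uE dis hv = shorter
      (walk-++ q hv (walk-++ (walk-reverse walkˡ) x₀w walkʳ))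
      (↭.++⁺ˡ E (↭.++⁺ʳ right (↭.↭-reverse left))) uE dis

    -- The path runs through `E` to `w`, along `right` to `x₁`, then jumps to `v` and goes back
    -- along `left`.
    detour-end : Adj G v x₁ → Walk G e E h → Unique E → Disjoint E xs → Adj G h w →
                 List.length E ≤ List.length γ
    detour-end {E = E} vx₁ q uE dis hw = shorter
      (walk-++ q hw (walk-++ walkʳ (adj-sym G vx₁) (walk-reverse walkˡ)))
      (↭.++⁺ˡ E (↭-trans (↭.++-comm right (reverse left)) (↭.++⁺ʳ right (↭.↭-reverse left))))
      uE dis

    bridge : Adj G v e → Walk G e E h → Unique E → Disjoint E xs → Adj G h w →
             List.length E ≤ List.length γ
    bridge {E = E} ve q uE dis hw = shorter
      (walk-++ walkˡ ve (walk-++ q hw walkʳ)) (↭.shifts left E) uE dis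

    -- The edges from `v` to `x₁` and from `w` to `x₀`, where present, close this list to a cycle.
    cycle : List (Fin n)
    cycle = left ++ reverse right

    cycle↭ : cycle ↭ left ++ right
    cycle↭ = ↭.++⁺ˡ left (↭.↭-reverse right)

    cycle⊆xs : u ∈ cycle → u ∈ xs
    cycle⊆xs = ⊆xs ∘ ↭.∈-resp-↭ cycle↭

    x₀∈cycle : x₀ ∈ cycle
    x₀∈cycle = ∈-++⁺ˡ (start∈ walkˡ)

    walk-cycle : Adj G v x₁ → Walk G x₀ cycle w
    walk-cycle vx₁ = walk-++ walkˡ vx₁ (walk-reverse walkʳ)

    -- After `E`, the whole cycle can be traversed from `u`, which gives |E| + p - |γ| vertices.
    -- Disjointness is asked from the cycle alone, so `E` may use vertices of `γ`.
    ear-bound : Adj G v x₁ → Adj G x₀ w → Walk G e E h → Unique E → Disjoint E cycle →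
                Adj G h u → u ∈ cycle → List.length E ≤ List.length γ
    ear-bound {E = E} {u = u} vx₁ x₀w q uE dis hu u∈
      with δ , ε , eq ← ∈-∃++ u∈
      with b , r ← rotate δ (subst (λ zs → Walk G x₀ zs w) eq (walk-cycle vx₁)) (adj-sym G x₀w) =
      ℕ.+-cancelʳ-≤ (List.length (left ++ right)) _ _
        (ℕ.≤-trans
          (maximal-↭ {E = E} (walk-++ q hu r) (↭.++⁺ˡ E perm) uE uniqᵏ
            λ (∈E , ∈R) → dis (∈E , ↭.∈-resp-↭ (↭-sym cycle↭) ∈R))
          (ℕ.≤-reflexive (sym lenᵏ)))
      where
      perm : u ∷ ε ++ δ ↭ left ++ right
      perm = ↭-trans (↭.++-comm (u ∷ ε) δ) (↭-trans (↭-reflexive (sym eq)) cycle↭)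

  no-exit-start : ∀ {y} → Adj G x₀ y → y ∈ xs
  no-exit-start {y} x₀y with y ∈? xs
  ... | yes y∈ = y∈
  ... | no  y∉ = ⊥-elim (ℕ.<-irrefl len
    (maximal (step (adj-sym G x₀y) walk) (All.¬Any⇒All¬ xs y∉ ∷ uniq)))

  no-exit-end : ∀ {y} → Adj G x₁ y → y ∈ xs
  no-exit-end {y} x₁y with y ∈? xs
  ... | yes y∈ = y∈
  ... | no  y∉ = ⊥-elim (ℕ.<-irrefl len (ℕ.≤-trans
    (s≤s (ℕ.≤-reflexive (sym (length-reverse xs))))
    (maximal (step (adj-sym G x₁y) (walk-reverse walk))
      (All.¬Any⇒All¬ _ (y∉ ∘ ↭.∈-resp-↭ (↭.↭-reverse xs)) ∷ Unique-↭ (↭-sym (↭.↭-reverse xs)) uniq))))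

  -- As labels, these mark the predecessors of neighbours of `x₀` and the successors of neighbours
  -- of `x₁`.
  F L : Fin n → Bool
  F v = does (adj? G x₀ v)
  L v = does (adj? G x₁ v)

  L⁻ : L v ≡ true → Adj G v x₁
  L⁻ = adj-sym G ∘ does⁻ (adj? G x₁ _)

  F⁻ : F v ≡ true → Adj G x₀ v
  F⁻ = does⁻ (adj? G x₀ _)

  -- Chord pairs that yield a cycle, and their effect on a second path

  module ShortChord {k : ℕ} (conn : k -Connected G) (2≤k : 2 ≤ k)
    {y₀ y₁ ys} (walkʸ : Walk G y₀ ys y₁) (uniqʸ : Unique ys)
    (I : Subset n) (⊆I : ∀ {v} → v ∈ xs → v ∈ ys → v ∈ˢ I)
    (α : List (Fin n)) (v : Fin n) (γ : List (Fin n)) (w : Fin n) (β : List (Fin n))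
    (eq : xs ≡ α ++ v ∷ γ ++ w ∷ β) (Lv : L v ≡ true) (Fw : F w ≡ true) where

    open Cut α v γ w β eq

    private
      ear : Walk G e E h → Unique E → Disjoint E cycle → Adj G h u → u ∈ cycle →
            List.length E ≤ List.length γ
      ear = ear-bound (L⁻ Lv) (F⁻ Fw)

    -- Leave q₁ towards the cycle avoiding q₂, and prepend q₂.
    ear-through : ∀ {q₁ q₂} → Adj G q₁ q₂ → q₁ ∉ cycle → q₂ ∉ cycle →
      ∃₂ λ z c → ∃ λ r → Walk G q₁ (q₁ ∷ r) z × Adj G z c × c ∈ cycle ×
        2 ⊕ List.length r ≤ List.length γ
    ear-through {q₁} {q₂} q₁q₂ q₁∉ q₂∉
      -- As 2 ≤ `k`, deleting the single vertex `q₂` leaves the graph connected.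
      with ys , q , avoid ← walk-avoiding conn Subset.⁅ q₂ ⁆ {a = q₁} {b = x₀}
             (ℕ.≤-trans (s≤s (ℕ.≤-reflexive (Subset.∣⁅x⁆∣≡1 q₂))) 2≤k)
             (λ q₁∈ → adj-irrefl G (Subset.x∈⁅y⁆⇒x≡y q₂ q₁∈) q₁q₂)
             (λ x₀∈ → q₂∉ (subst (_∈ cycle) (Subset.x∈⁅y⁆⇒x≡y q₂ x₀∈) x₀∈cycle))
      with zs , z , c , q′ , zs⊆ , zc , c∈ ← first-hit cycle q q₁∉ x₀∈cycle
      with ζ , q″ , uζ , ζ⊆ ← erase-loops q′
      with r , refl ← cons-start q″ =
      z , c , r , q″ , zc , c∈ ,
      ear (step (adj-sym G q₁q₂) q″) (All.¬Any⇒All¬ _ q₂∉ζ ∷ uζ) dis zc c∈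
      where
      q₂∉ζ : q₂ ∉ q₁ ∷ r
      q₂∉ζ q₂∈ = avoid (proj₁ (zs⊆ (ζ⊆ q₂∈))) (Subset.x∈⁅x⁆ q₂)
      dis : Disjoint (q₂ ∷ q₁ ∷ r) cycle
      dis (here refl , ∈c) = q₂∉ ∈c
      dis (there ∈ζ , ∈c)  = proj₂ (zs⊆ (ζ⊆ ∈ζ)) ∈c

    on-cycle : Fin n → Bool
    on-cycle u = does (u ∈? cycle)

    count-on-cycle : count on-cycle ys ≤ ∣ I ∣
    count-on-cycle = count≤card on-cycle uniqʸ I
      λ {u} u∈ys on → ⊆I (cycle⊆xs (does⁻ (u ∈? cycle) on)) u∈ys

    off-cycle : on-cycle u ≡ false → u ∉ cycle
    off-cycle {u} off u∈ rewrite dec-true (u ∈? cycle) u∈ with () ← off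

    module Run (δ : List (Fin n)) {q₁ q₂ : Fin n} {ε : List (Fin n)}
      (eqʸ : ys ≡ δ ++ q₁ ∷ q₂ ∷ ε) where

      suffix : Walk G q₁ (q₁ ∷ q₂ ∷ ε) y₁
      suffix = proj₂ (walk-split δ (subst (λ zs → Walk G y₀ zs y₁) eqʸ walkʸ))

      q₁q₂ : Adj G q₁ q₂
      q₁q₂ = proj₁ (walk-uncons suffix)

      suffix-unique : Unique (q₁ ∷ q₂ ∷ ε)
      suffix-unique = proj₁ (proj₂ (Unique-++⁻ δ (subst Unique eqʸ uniqʸ)))

    -- Two consecutive vertices of `ys` off the cycle would yield an ear with at least two vertices,
    -- more than `γ` has. So every run off the cycle has at most one vertex.
    length-bound₁ : List.length γ ≡ 1 → List.length ys ≤ 2 ⊛ ∣ I ∣ ⊕ 1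
    length-bound₁ γ≡1 = ℕ.≤-trans (count≤length 1 on-cycle ys runs)
      (ℕ.+-monoˡ-≤ 1 (ℕ.*-monoʳ-≤ 2 count-on-cycle))
      where
      runs : ∀ δ ρ ε → ys ≡ δ ++ ρ ++ ε → All (λ u → on-cycle u ≡ false) ρ → List.length ρ ≤ 1
      runs δ []           ε eqʸ off = z≤n
      runs δ (_ ∷ [])     ε eqʸ off = s≤s z≤n
      runs δ (q₁ ∷ q₂ ∷ ρ) ε eqʸ (off₁ ∷ off₂ ∷ _)
        with ear-through (Run.q₁q₂ δ eqʸ) (off-cycle off₁) (off-cycle off₂)
      ... | _ , _ , _ , _ , _ , _ , 2≤ rewrite γ≡1 with s≤s () ← 2≤

    -- Let `q₁`, `q₂`, `q₃` be consecutive on `ys` and off the cycle. The ear leaving through `q₁`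
    -- with `q₂` prepended has three vertices unless `q₁` itself is adjacent to the cycle, and then
    -- `q₃`, `q₂`, `q₁` form an ear of three vertices.
    length-bound₂ : List.length γ ≡ 2 → List.length ys ≤ 3 ⊛ ∣ I ∣ ⊕ 2
    length-bound₂ γ≡2 = ℕ.≤-trans (count≤length 2 on-cycle ys runs)
      (ℕ.+-monoˡ-≤ 2 (ℕ.*-monoʳ-≤ 3 count-on-cycle))
      where
      runs : ∀ δ ρ ε → ys ≡ δ ++ ρ ++ ε → All (λ u → on-cycle u ≡ false) ρ → List.length ρ ≤ 2
      runs δ []           ε eqʸ off = z≤n
      runs δ (_ ∷ [])     ε eqʸ off = s≤s z≤n
      runs δ (_ ∷ _ ∷ []) ε eqʸ off = s≤s (s≤s z≤n)
      runs δ (q₁ ∷ q₂ ∷ q₃ ∷ ρ) ε eqʸ (off₁ ∷ off₂ ∷ off₃ ∷ _)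
        with ear-through (Run.q₁q₂ δ eqʸ) (off-cycle off₁) (off-cycle off₂)
      ... | _ , _ , _ ∷ _ , _ , _ , _ , 3≤ rewrite γ≡2 with s≤s (s≤s ()) ← 3≤
      runs δ (q₁ ∷ q₂ ∷ q₃ ∷ ρ) ε eqʸ (off₁ ∷ off₂ ∷ off₃ ∷ _)
          | z , c , [] , q , zc , c∈ , _
        with refl ← singleton-ends q
        with q₂q₃ , _ ← walk-uncons (proj₂ (walk-uncons (Run.suffix δ eqʸ)))
        with (q₁≢q₂ ∷ q₁≢q₃ ∷ _) ∷ (q₂≢q₃ ∷ _) ∷ _ ← Run.suffix-unique δ eqʸ
        with ear {E = q₃ ∷ q₂ ∷ q₁ ∷ []}
               (step (adj-sym G q₂q₃) (step (adj-sym G (Run.q₁q₂ δ eqʸ)) end))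
               ((q₂≢q₃ ∘ sym ∷ q₁≢q₃ ∘ sym ∷ []) ∷ (q₁≢q₂ ∘ sym ∷ []) ∷ [] ∷ [])
               (λ { (here refl , ∈c)                 → off-cycle off₃ ∈c
                  ; (there (here refl) , ∈c)         → off-cycle off₂ ∈c
                  ; (there (there (here refl)) , ∈c) → off-cycle off₁ ∈c })
               zc c∈
      ... | 3≤ rewrite γ≡2 with s≤s (s≤s ()) ← 3≤

  -- The component of `h₀` off the path, and lower bounds on `p`

  module Component {k : ℕ} (conn : k -Connected G) {h₀ : Fin n} (h₀∉ : h₀ ∉ xs) where

    Reached : Fin n → Set
    Reached h = ∃ λ zs → Walk G h₀ zs h × (∀ {v} → v ∈ zs → v ∉ xs)

    reached∉ : Reached h → h ∉ xs
    reached∉ (_ , q , avoid) = avoid (end∈ q)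

    Attached : Fin n → Set
    Attached v = v ∈ xs × ∃ λ h → Adj G h v × Reached h

    reached-path : Reached e → Reached h → ∃ λ r → Walk G e (e ∷ r) h × Unique (e ∷ r) × Disjoint (e ∷ r) xs
    reached-path (zs , p , avoid) (zs′ , q , avoid′)
      with r , refl ← cons-start q
      with ys , s , u , ys⊆ ← erase-loops (walk-join (walk-reverse p) q)
      with r′ , refl ← cons-start s = r′ , s , u , dis
      where
      dis : Disjoint (_ ∷ r′) xs
      dis (∈ys , ∈xs) with ∈-++⁻ (reverse zs) (ys⊆ ∈ys)
      ... | inj₁ ∈rev = avoid (↭.∈-resp-↭ (↭.↭-reverse zs) ∈rev) ∈xs
      ... | inj₂ ∈r   = avoid′ (there ∈r) ∈xs

    -- The neighbours of `x₀` all lie on the path and separate `x₀` from `h₀`. They are counted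
    -- along the tail because `x₀` is not its own neighbour, which is the form `labels` uses.
    k≤countF : ∀ r → xs ≡ x₀ ∷ r → k ≤ count F r
    k≤countF r eq = ℕ.≤-trans
      (k≤∣separator∣ conn ⟦ F ⟧ (_≡ x₀) refl (λ { refl → h₀∉ (start∈ walk) })
        (λ x₀∈ → adj-irrefl G refl (F⁻ (∈⟦⟧⁻ F x₀∈)))
        (λ h₀∈ → h₀∉ (no-exit-start (F⁻ (∈⟦⟧⁻ F h₀∈))))
        λ { refl e v∉ → ⊥-elim (v∉ (∈⟦⟧⁺ F (dec-true (adj? G x₀ _) e))) })
      (card≤count F r ⟦ F ⟧ λ v∈ → let Fv = ∈⟦⟧⁻ F v∈ in
        in-rest (subst (_ ∈_) eq (no-exit-start (F⁻ Fv))) (F⁻ Fv) , Fv)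
      where
      in-rest : v ∈ x₀ ∷ r → Adj G x₀ v → v ∈ r
      in-rest (here refl) e = ⊥-elim (adj-irrefl G refl e)
      in-rest (there v∈)  _ = v∈

    k≤countL : k ≤ count L xs
    k≤countL = ℕ.≤-trans
      (k≤∣separator∣ conn ⟦ L ⟧ (_≡ x₁) refl (λ { refl → h₀∉ (end∈ walk) })
        (λ x₁∈ → adj-irrefl G refl (L⁻ (∈⟦⟧⁻ L x₁∈)))
        (λ h₀∈ → h₀∉ (no-exit-end (adj-sym G (L⁻ (∈⟦⟧⁻ L h₀∈)))))
        λ { refl e v∉ → ⊥-elim (v∉ (∈⟦⟧⁺ L (dec-true (adj? G x₁ _) e))) })
      (card≤count L xs ⟦ L ⟧ λ v∈ → let Lv = ∈⟦⟧⁻ L v∈ in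
        no-exit-end (adj-sym G (L⁻ Lv)) , Lv)

    -- A decision of attachment is assumed so that attached vertices can be counted. It is later
    -- supplied under a double negation, which is harmless for decidable bounds.
    module Bounds (attached? : ∀ v → Dec (Attached v)) where

      N : Fin n → Bool
      N v = does (attached? v)

      N⁻ : N v ≡ true → Attached v
      N⁻ = does⁻ (attached? _)

      x₀-unattached : ¬ Attached x₀
      x₀-unattached (_ , h , e , r) = reached∉ r (no-exit-start (adj-sym G e))

      -- The attached vertices separate the component from `x₀`: an edge leaving a reached vertex
      -- ends at a reached or an attached one.
      k≤countN : k ≤ count N xs
      k≤countN = ℕ.≤-trans
        (k≤∣separator∣ conn ⟦ N ⟧ Reached
          (h₀ ∷ [] , end , λ { (here refl) → h₀∉ })
          (λ r → reached∉ r (start∈ walk))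
          (λ h₀∈ → h₀∉ (proj₁ (N⁻ (∈⟦⟧⁻ N h₀∈))))
          (x₀-unattached ∘ N⁻ ∘ ∈⟦⟧⁻ N)
          closed)
        (card≤count N xs ⟦ N ⟧ λ v∈ → let Nv = ∈⟦⟧⁻ N v∈ in proj₁ (N⁻ Nv) , Nv)
        where
        closed : Reached u → Adj G u v → v ∉ˢ ⟦ N ⟧ → Reached v
        closed {u} {v} r@(zs , q , avoid) e v∉ with v ∈? xs
        ... | yes v∈ = ⊥-elim (v∉ (∈⟦⟧⁺ N (dec-true (attached? v) (v∈ , u , e , r))))
        ... | no  v∉xs = zs ∷ʳ v , walk-++ q e end , avoid′
          where
          avoid′ : ∀ {w} → w ∈ zs ∷ʳ v → w ∉ xs
          avoid′ w∈ with ∈-++⁻ zs w∈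
          ... | inj₁ w∈zs       = avoid w∈zs
          ... | inj₂ (here refl) = v∉xs

      last∉L : ∀ α v → xs ≡ α ++ v ∷ [] → L v ≡ false
      last∉L α v eq
        with refl ← singleton-ends (proj₂ (walk-split α (subst (λ zs → Walk G x₀ zs x₁) eq walk))) =
        ≢true⇒≡false (adj-irrefl G refl ∘ L⁻)

      singleton-disjoint : h ∉ xs → Disjoint (h ∷ []) xs
      singleton-disjoint h∉ (here refl , h∈) = h∉ h∈

      -- The removed segment is empty, so inserting the single vertex `h` would lengthen the path.
      NF : ∀ α v w β → xs ≡ α ++ v ∷ w ∷ β → N v ≡ true → F w ≡ true → ⊥
      NF α v w β eq Nv Fw with _ , h , hv , r ← N⁻ Nv
        with () ← Cut.detour-start α v [] w β eq (F⁻ Fw) end ([] ∷ [])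
                    (singleton-disjoint (reached∉ r)) hv

      LN : ∀ α v w β → xs ≡ α ++ v ∷ w ∷ β → L v ≡ true → N w ≡ true → ⊥
      LN α v w β eq Lv Nw with _ , h , hw , r ← N⁻ Nw
        with () ← Cut.detour-end α v [] w β eq (L⁻ Lv) end ([] ∷ [])
                    (singleton-disjoint (reached∉ r)) hw

      -- A path inside the component could be inserted between `v` and `w`.
      NN : ∀ α v w β → xs ≡ α ++ v ∷ w ∷ β → N v ≡ true → N w ≡ true → ⊥
      NN α v w β eq Nv Nw
        with _ , h , hv , r ← N⁻ Nv
        with _ , h′ , h′w , r′ ← N⁻ Nw
        with _ , q , u , dis ← reached-path r r′
        with () ← Cut.bridge α v [] w β eq (adj-sym G hv) q u dis h′w

      k+k≤p : k ⊕ k ≤ p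
      k+k≤p with r , eq ← cons-start walk = ℕ.≤-trans
        (ℕ.+-mono-≤ (ℕ.≤-trans (k≤countF r eq) (ℕ.m≤m+n _ _)) k≤countN)
        (ℕ.≤-trans
          -- Taking the empty label for `L` leaves `NF` as the only exclusion to check.
          (Labels.labels xs F (λ _ → false) N (λ _ _ _ → refl) NF
            (λ _ _ _ _ _ ()) (λ _ _ _ _ _ _ ()) x₀ r eq)
          (ℕ.≤-reflexive len))

      module _ (L·F : ∀ α u v w β → xs ≡ α ++ u ∷ v ∷ w ∷ β → L u ≡ true → F w ≡ true → ⊥) where

        open Labels xs F L N last∉L NF LN L·F

        k+k+k≤p : k ⊕ k ⊕ k ≤ p
        k+k+k≤p with r , eq ← cons-start walk = ℕ.≤-trans
          (ℕ.+-mono-≤ (ℕ.+-mono-≤ (k≤countF r eq) k≤countL) k≤countN)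
          (ℕ.≤-trans (labels x₀ r eq) (ℕ.≤-reflexive len))

        module _ (L··F : ∀ α t u v w β → xs ≡ α ++ t ∷ u ∷ v ∷ w ∷ β → L t ≡ true → F w ≡ true → ⊥)
          {h₁ : Fin n} (h₀h₁ : Adj G h₀ h₁) (h₁∉ : h₁ ∉ xs) where

          -- The neighbour is `h₁` if the walk back from `h` to `h₀` is trivial, and otherwise the
          -- next vertex on that walk.
          reached-edge : Reached h → ∃ λ e → Adj G e h × Disjoint (e ∷ h ∷ []) xs
          reached-edge r@(zs , q , avoid) =
            find (walk-reverse q) (avoid ∘ ↭.∈-resp-↭ (↭.↭-reverse zs))
            where
            find : ∀ {ws} → Walk G h ws h₀ → (∀ {v} → v ∈ ws → v ∉ xs) →
                   ∃ λ e → Adj G e h × Disjoint (e ∷ h ∷ []) xs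
            find end avoid = h₁ , adj-sym G h₀h₁ ,
              λ { (here refl , ∈xs)         → h₁∉ ∈xs
                ; (there (here refl) , ∈xs) → h₀∉ ∈xs }
            find (step e p) avoid = _ , adj-sym G e ,
              λ { (here refl , ∈xs)         → avoid (there (start∈ p)) ∈xs
                ; (there (here refl) , ∈xs) → avoid (here refl) ∈xs }

          edge-unique : Adj G e h → Unique (e ∷ h ∷ [])
          edge-unique eh = ((λ e≡h → adj-irrefl G e≡h eh) ∷ []) ∷ [] ∷ []

          -- The two vertices `e` and `h` would replace the single vertex `v`.
          N·F : ∀ α u v w β → xs ≡ α ++ u ∷ v ∷ w ∷ β → N u ≡ true → F w ≡ true → ⊥
          N·F α u v w β eq Nu Fw
            with _ , h , hu , r ← N⁻ Nu
            with e , eh , dis ← reached-edge r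
            with s≤s () ← Cut.detour-start α u (v ∷ []) w β eq (F⁻ Fw)
                            (step eh end) (edge-unique eh) dis hu

          L·N : ∀ α u v w β → xs ≡ α ++ u ∷ v ∷ w ∷ β → L u ≡ true → N w ≡ true → ⊥
          L·N α u v w β eq Lu Nw
            with _ , h , hw , r ← N⁻ Nw
            with e , eh , dis ← reached-edge r
            with s≤s () ← Cut.detour-end α u (v ∷ []) w β eq (L⁻ Lu)
                            (step eh end) (edge-unique eh) dis hw

          4k≤1+p : k ⊕ k ⊕ (k ⊕ k) ≤ 1 ⊕ p
          4k≤1+p with r , eq ← cons-start walk = ℕ.≤-trans
            (ℕ.+-mono-≤ (ℕ.+-mono-≤ (k≤countF r eq) k≤countL) (ℕ.+-mono-≤ k≤countN k≤countN))
            (ℕ.≤-trans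
              (Gaps.gaps NN N·F L·N L··F x₀ r eq (≢true⇒≡false (x₀-unattached ∘ N⁻)))
              (ℕ.≤-reflexive (cong (1 ⊕_) len)))

-- Double negation, inclusion-exclusion and the integer ceiling

¬¬-all-dec : ∀ {n} (P : Fin n → Set) → ¬ ¬ (∀ v → Dec (P v))
¬¬-all-dec {ℕ.zero}  P ¬dec = ¬dec λ ()
¬¬-all-dec {ℕ.suc n} P ¬dec = ¬¬-excluded-middle λ d → ¬¬-all-dec (P ∘ suc) λ ds →
  ¬dec λ { zero → d ; (suc v) → ds v }

count-complement : ∀ (f : A → Bool) xs → List.length xs ≡ count f xs ⊕ count (not ∘ f) xs
count-complement f []       = refl
count-complement f (x ∷ xs) with f x
... | true  = cong ℕ.suc (count-complement f xs)
... | false = trans (cong ℕ.suc (count-complement f xs)) (sym (ℕ.+-suc _ _))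

-- The vertices of `ys` on `xs` lie in `I`, and the others lie in the complement of `xs`.
length+length≤ : ∀ {xs ys : List (Fin n)} → Unique xs → Unique ys → (I : Subset n) →
  (∀ {v} → v ∈ xs → v ∈ ys → v ∈ˢ I) → List.length xs ⊕ List.length ys ≤ n ⊕ ∣ I ∣
length+length≤ {n} {xs} {ys} uxs uys I ⊆I = begin
  List.length xs ⊕ List.length ys                       ≡⟨ cong₂ _⊕_ (sym (count-true xs)) (count-complement f ys) ⟩
  count (λ _ → true) xs ⊕ (count f ys ⊕ count (not ∘ f) ys) ≤⟨ ℕ.+-mono-≤ xs≤ (ℕ.+-mono-≤ ∩≤ rest≤) ⟩
  ∣ ⟦ f ⟧ ∣ ⊕ (∣ I ∣ ⊕ ∣ Subset.∁ ⟦ f ⟧ ∣)               ≡⟨ cong (λ c → ∣ ⟦ f ⟧ ∣ ⊕ (∣ I ∣ ⊕ c)) (Subset.∣∁p∣≡n∸∣p∣ ⟦ f ⟧) ⟩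
  ∣ ⟦ f ⟧ ∣ ⊕ (∣ I ∣ ⊕ (n ℕ.∸ ∣ ⟦ f ⟧ ∣))                ≡⟨ regroup ∣ ⟦ f ⟧ ∣ ∣ I ∣ _ ⟩
  (∣ ⟦ f ⟧ ∣ ⊕ (n ℕ.∸ ∣ ⟦ f ⟧ ∣)) ⊕ ∣ I ∣                ≡⟨ cong (_⊕ ∣ I ∣) (ℕ.m+[n∸m]≡n (Subset.∣p∣≤n ⟦ f ⟧)) ⟩
  n ⊕ ∣ I ∣                                             ∎
  where
  open ℕ.≤-Reasoning
  f : Fin n → Bool
  f v = does (v ∈? xs)
  regroup : ∀ a b c → a ⊕ (b ⊕ c) ≡ (a ⊕ c) ⊕ b
  regroup = solve-∀
  xs≤ : count (λ _ → true) xs ≤ ∣ ⟦ f ⟧ ∣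
  xs≤ = count≤card _ uxs ⟦ f ⟧ λ v∈ _ → ∈⟦⟧⁺ f (dec-true (_ ∈? xs) v∈)
  ∩≤ : count f ys ≤ ∣ I ∣
  ∩≤ = count≤card f uys I λ v∈ys fv → ⊆I (does⁻ (_ ∈? xs) fv) v∈ys
  not-true : ∀ {b} → not b ≡ true → b ≡ true → ⊥
  not-true {false} _ ()
  rest≤ : count (not ∘ f) ys ≤ ∣ Subset.∁ ⟦ f ⟧ ∣
  rest≤ = count≤card (not ∘ f) uys (Subset.∁ ⟦ f ⟧) λ _ ¬fv →
    Subset.x∉p⇒x∈∁p (not-true ¬fv ∘ ∈⟦⟧⁻ f)

∈-vertexSet : {G : Graph (Fin n)} (P : Path G) → ∀ {v} → v ∈ vertices P → v ∈ˢ vertexSet P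
∈-vertexSet {n} P = ∈-⋃ (vertices P)
  where
  ∈-⋃ : ∀ (xs : List (Fin n)) {v} → v ∈ xs → v ∈ˢ Subset.⋃ (List.map Subset.⁅_⁆ xs)
  ∈-⋃ (x ∷ xs) (here refl) = Subset.x∈p∪q⁺ (inj₁ (Subset.x∈⁅x⁆ x))
  ∈-⋃ (x ∷ xs) (there v∈)  = Subset.x∈p∪q⁺ (inj₂ (∈-⋃ xs v∈))

longest-maximal : {G : Graph (Fin n)} (P : Path G) → Longest P →
  ∀ {a b xs} → Walk G a xs b → Unique xs → List.length xs ≤ List.length (vertices P)
longest-maximal {G = G} P longest q u with r , refl ← Walks.cons-start G q =
  s≤s (longest (record { linked = Walks.walk⇒linked G q ; unique = u }))

-- The ceiling is -q, where q is the floor of -x/3. If q < -m, then -x < 3(q + 1) ≤ -3m ≤ -x.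
ceiling[x/3]≤ : ∀ x m → x ℤ.≤ + m * + 3 → ceiling (x / 3) ℤ.≤ + m
ceiling[x/3]≤ x m x≤ = subst₂ ℤ._≤_ (cong ℤ.-_ (sym (ℤ.div-pos-is-/ℕ (ℤ.- x) 3))) (ℤ.neg-involutive (+ m)) (ℤ.neg-mono-≤ -m≤q)
  where
  q = (ℤ.- x) ℤ./ℕ 3
  -m≤q : ℤ.- + m ℤ.≤ q
  -m≤q with ℤ.- + m ℤ.≤? q
  ... | yes ≤q = ≤q
  ... | no  ≰q = ⊥-elim (ℤ.<-irrefl refl (begin-strict
    ℤ.- x                 <⟨ ℤ.n<s[n/ℕd]*d (ℤ.- x) 3 ⟩
    ℤ.suc q * + 3         ≤⟨ ℤ.*-monoʳ-≤-nonNeg (+ 3) (ℤ.i<j⇒suc[i]≤j (ℤ.≰⇒> ≰q)) ⟩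
    (ℤ.- + m) * + 3       ≡⟨ sym (ℤ.neg-distribˡ-* (+ m) (+ 3)) ⟩
    ℤ.- (+ m * + 3)       ≤⟨ ℤ.neg-mono-≤ x≤ ⟩
    ℤ.- x                 ∎))
    where open ℤ.≤-Reasoning

8k-n-4≤3m : ∀ k n m → 8 ⊛ k ≤ n ⊕ 4 ⊕ m ⊛ 3 → + 8 * + k - + n - + 4 ℤ.≤ + m * + 3
8k-n-4≤3m k n m bound = begin
  + 8 * + k - + n - + 4                   ≡⟨ cong (λ z → z - + n - + 4) (sym (ℤ.pos-* 8 k)) ⟩
  + (8 ⊛ k) - + n - + 4                   ≤⟨ ℤ.+-monoˡ-≤ (ℤ.- + 4) (ℤ.+-monoˡ-≤ (ℤ.- + n) (ℤ.+≤+ bound)) ⟩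
  + n ℤ.+ + 4 ℤ.+ + (m ⊛ 3) - + n - + 4   ≡⟨ cancel (+ n) (+ 4) (+ (m ⊛ 3)) ⟩
  + (m ⊛ 3)                               ≡⟨ ℤ.pos-* m 3 ⟩
  + m * + 3                               ∎
  where
  open ℤ.≤-Reasoning
  cancel : ∀ a b c → a ℤ.+ b ℤ.+ c - a - b ≡ c
  cancel = ℤ-solve-∀

-- Combining the bounds for two longest paths

module TwoLongestPaths (k : ℕ) (1≤k : 1 ≤ k) (G : Graph (Fin n)) (conn : k -Connected G)
  (P Q : Path G) (longestP : Longest P) (longestQ : Longest Q) where

  open Walks G

  I : Subset n
  I = vertexSet P ∩ vertexSet Q

  m p : ℕ
  m = ∣ I ∣
  p = List.length (vertices P)

  xs ys : List (Fin n)
  xs = vertices P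
  ys = vertices Q

  ⊆I : ∀ {v} → v ∈ xs → v ∈ ys → v ∈ˢ I
  ⊆I v∈xs v∈ys = Subset.x∈p∩q⁺ (∈-vertexSet P v∈xs , ∈-vertexSet Q v∈ys)

  ∣Q∣≡p : List.length ys ≡ p
  ∣Q∣≡p = cong ℕ.suc (ℕ.≤-antisym (longestP Q) (longestQ P))

  2p≤n+m : p ⊕ p ≤ n ⊕ m
  2p≤n+m = subst (λ q → p ⊕ q ≤ n ⊕ m) ∣Q∣≡p (length+length≤ (unique P) (unique Q) I ⊆I)

  walkᴾ : Walk G (start P) xs (proj₁ (linked⇒walk _ _ (linked P)))
  walkᴾ = proj₂ (linked⇒walk _ _ (linked P))

  endᵟ : Fin n
  endᵟ = proj₁ (linked⇒walk _ _ (linked Q))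

  walkᵟ : Walk G (start Q) ys endᵟ
  walkᵟ = proj₂ (linked⇒walk _ _ (linked Q))

  open LongestWalk G (longest-maximal P longestP) walkᴾ (unique P) refl

  module _ (m<k : m < k) where

    open ℕ.≤-Reasoning

    -- If `P` were spanning, n ≤ p and 2p ≤ n + m would give p ≤ m < k < n ≤ p.
    exterior : ∃ λ v → v ∉ xs
    exterior with any? (λ v → ¬? (v ∈? xs))
    ... | yes found = found
    ... | no  none  = ⊥-elim (ℕ.<-irrefl refl (begin-strict
      m  <⟨ m<k ⟩
      k  <⟨ proj₁ conn ⟩
      n  ≤⟨ n≤p ⟩
      p  ≤⟨ ℕ.+-cancelˡ-≤ p p m (ℕ.≤-trans 2p≤n+m (ℕ.+-monoˡ-≤ m n≤p)) ⟩
      m  ∎))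
      where
      n≤p : n ≤ p
      n≤p = n≤length xs λ v → decidable-stable (v ∈? xs) λ v∉ → none (v , v∉)

    k+k≤∣P∣ : k ⊕ k ≤ p
    k+k≤∣P∣ = decidable-stable (_ ℕ.≤? _) λ ¬bound →
      ¬¬-all-dec _ λ attached? →
        ¬bound (Component.Bounds.k+k≤p conn (proj₂ exterior) attached?)

    2m+1<p : 2 ⊛ m ⊕ 1 < p
    2m+1<p = begin-strict
      2 ⊛ m ⊕ 1           <⟨ ℕ.≤-reflexive (arith m) ⟩
      (1 ⊕ m) ⊕ (1 ⊕ m)   ≤⟨ ℕ.+-mono-≤ m<k m<k ⟩
      k ⊕ k               ≤⟨ k+k≤∣P∣ ⟩
      p                   ∎
      where
      arith : ∀ m → 1 ⊕ (2 ⊛ m ⊕ 1) ≡ (1 ⊕ m) ⊕ (1 ⊕ m)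
      arith = solve-∀

    -- Without such an edge no two consecutive vertices of `Q` lie off `P`, which forces p ≤ 2m + 1.
    -- The double negation suffices because the edge serves to prove a decidable inequality.
    exterior-edge : ¬ ¬ (∃₂ λ h₀ h₁ → Adj G h₀ h₁ × h₀ ∉ xs × h₁ ∉ xs)
    exterior-edge none = ℕ.<⇒≱ 2m+1<p (subst (_≤ 2 ⊛ m ⊕ 1) ∣Q∣≡p
      (ℕ.≤-trans (count≤length 1 on-P ys runs) (ℕ.+-monoˡ-≤ 1 (ℕ.*-monoʳ-≤ 2 on-P≤m))))
      where
      on-P : Fin n → Bool
      on-P v = does (v ∈? xs)
      on-P≤m : count on-P ys ≤ m
      on-P≤m = count≤card on-P (unique Q) I λ v∈ys on → ⊆I (does⁻ (_ ∈? xs) on) v∈ys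
      off-P : ∀ {v} → on-P v ≡ false → v ∉ xs
      off-P {v} off v∈ rewrite dec-true (v ∈? xs) v∈ with () ← off
      runs : ∀ δ ρ β → ys ≡ δ ++ ρ ++ β → All (λ u → on-P u ≡ false) ρ → List.length ρ ≤ 1
      runs δ []            β eq off = z≤n
      runs δ (_ ∷ [])      β eq off = s≤s z≤n
      runs δ (q₁ ∷ q₂ ∷ ρ) β eq (off₁ ∷ off₂ ∷ _) = ⊥-elim (none (q₁ , q₂ ,
        proj₁ (walk-uncons (proj₂ (walk-split δ (subst (λ zs → Walk G (Path.start Q) zs endᵟ) eq walkᵟ)))) ,
        off-P off₁ , off-P off₂))

    4k≤1+∣P∣ : 2 ≤ k → k ⊕ k ⊕ (k ⊕ k) ≤ 1 ⊕ p
    4k≤1+∣P∣ 2≤k = decidable-stable (_ ℕ.≤? _) λ ¬bound →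
      exterior-edge λ (h₀ , h₁ , h₀h₁ , h₀∉ , h₁∉) →
      ¬¬-all-dec _ λ attached? →
        let open Component.Bounds conn h₀∉ attached?
        -- The exclusions come in order: `L·F` gives 3k ≤ p, which in turn rules out the longer
        -- chord pair.
        in ¬bound (4k≤1+p L·F (L··F (k+k+k≤p L·F)) h₀h₁ h₁∉)
      where
      L·F : ∀ α u v w β → xs ≡ α ++ u ∷ v ∷ w ∷ β → L u ≡ true → F w ≡ true → ⊥
      L·F α u v w β eq Lu Fw = ℕ.<⇒≱ 2m+1<p (subst (_≤ 2 ⊛ m ⊕ 1) ∣Q∣≡p
        (ShortChord.length-bound₁ conn 2≤k walkᵟ (unique Q) I ⊆I α u (v ∷ []) w β eq Lu Fw refl))

      3m+2<k+k+k : 3 ⊛ m ⊕ 2 < k ⊕ k ⊕ k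
      3m+2<k+k+k = begin-strict
        3 ⊛ m ⊕ 2                       <⟨ ℕ.≤-reflexive (arith m) ⟩
        (1 ⊕ m) ⊕ (1 ⊕ m) ⊕ (1 ⊕ m)     ≤⟨ ℕ.+-mono-≤ (ℕ.+-mono-≤ m<k m<k) m<k ⟩
        k ⊕ k ⊕ k                       ∎
        where
        arith : ∀ m → 1 ⊕ (3 ⊛ m ⊕ 2) ≡ (1 ⊕ m) ⊕ (1 ⊕ m) ⊕ (1 ⊕ m)
        arith = solve-∀

      L··F : k ⊕ k ⊕ k ≤ p →
        ∀ α t u v w β → xs ≡ α ++ t ∷ u ∷ v ∷ w ∷ β → L t ≡ true → F w ≡ true → ⊥
      L··F 3k≤p α t u v w β eq Lt Fw = ℕ.<⇒≱ (ℕ.<-≤-trans 3m+2<k+k+k 3k≤p) (subst (_≤ 3 ⊛ m ⊕ 2) ∣Q∣≡p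
        (ShortChord.length-bound₂ conn 2≤k walkᵟ (unique Q) I ⊆I α t (u ∷ v ∷ []) w β eq Lt Fw refl))

    8k≤n+4+3m : 8 ⊛ k ≤ n ⊕ 4 ⊕ m ⊛ 3
    8k≤n+4+3m with ℕ.m≤n⇒m<n∨m≡n 1≤k
    ... | inj₁ 2≤k = begin
      8 ⊛ k                                     ≡⟨ split k ⟩
      (k ⊕ k ⊕ (k ⊕ k)) ⊕ (k ⊕ k ⊕ (k ⊕ k))     ≤⟨ ℕ.+-mono-≤ (4k≤1+∣P∣ 2≤k) (4k≤1+∣P∣ 2≤k) ⟩
      (1 ⊕ p) ⊕ (1 ⊕ p)                         ≡⟨ twice p ⟩
      2 ⊕ (p ⊕ p)                               ≤⟨ ℕ.+-monoʳ-≤ 2 2p≤n+m ⟩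
      -- Here 8k ≤ n + m + 2 is established; the remaining lines weaken it to the stated form.
      2 ⊕ (n ⊕ m)                               ≤⟨ ℕ.m≤m+n _ (2 ⊕ 2 ⊛ m) ⟩
      2 ⊕ (n ⊕ m) ⊕ (2 ⊕ 2 ⊛ m)                 ≡⟨ collect n m ⟩
      n ⊕ 4 ⊕ m ⊛ 3                             ∎
      where
      split : ∀ k → 8 ⊛ k ≡ (k ⊕ k ⊕ (k ⊕ k)) ⊕ (k ⊕ k ⊕ (k ⊕ k))
      split = solve-∀
      twice : ∀ p → (1 ⊕ p) ⊕ (1 ⊕ p) ≡ 2 ⊕ (p ⊕ p)
      twice = solve-∀
      collect : ∀ n m → 2 ⊕ (n ⊕ m) ⊕ (2 ⊕ 2 ⊛ m) ≡ n ⊕ 4 ⊕ m ⊛ 3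
      collect = solve-∀
    -- For k = 1, 2 ≤ p gives 8 ≤ 2p + 4 ≤ n + m + 4.
    ... | inj₂ refl = begin
      4 ⊕ 4                 ≤⟨ ℕ.+-monoˡ-≤ 4 (ℕ.+-mono-≤ k+k≤∣P∣ k+k≤∣P∣) ⟩
      (p ⊕ p) ⊕ 4           ≤⟨ ℕ.+-monoˡ-≤ 4 2p≤n+m ⟩
      (n ⊕ m) ⊕ 4           ≤⟨ ℕ.m≤m+n _ (2 ⊛ m) ⟩
      (n ⊕ m) ⊕ 4 ⊕ 2 ⊛ m   ≡⟨ collect n m ⟩
      n ⊕ 4 ⊕ m ⊛ 3         ∎
      where
      collect : ∀ n m → (n ⊕ m) ⊕ 4 ⊕ 2 ⊛ m ≡ n ⊕ 4 ⊕ m ⊛ 3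
      collect = solve-∀

theorem1p4 : (k : ℕ) → k ℕ.≥ 1 → (n : ℕ) (G : Graph (Fin n)) → k -Connected G →
    (P Q : Path G) → Longest P → Longest Q →
    + ∣ vertexSet P ∩ vertexSet Q ∣ ≥ + k ⊓ ceiling ((+ 8 * + k - + n - + 4) / 3)
theorem1p4 k 1≤k n G conn P Q longestP longestQ with ℕ.<-≤-connex ∣ vertexSet P ∩ vertexSet Q ∣ k
-- The minimum is bounded through the ceiling when m < k, and through `k` otherwise.
... | inj₁ m<k = ℤ.≤-trans (ℤ.i⊓j≤j _ _)
  (ceiling[x/3]≤ _ m (8k-n-4≤3m k n m
    (TwoLongestPaths.8k≤n+4+3m k 1≤k G conn P Q longestP longestQ m<k)))
  where m = ∣ vertexSet P ∩ vertexSet Q ∣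
... | inj₂ k≤m = ℤ.≤-trans (ℤ.i⊓j≤i _ _) (ℤ.+≤+ k≤m)
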